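{- Let $k\geq 2$ and $n\geq k$ be integers. Then in $\mathcal{H}$, $$ \sum_{\substack{r, s_i\geq 1\\ r+s_1+\cdots +s_{k-1}=n}} z_{r}\,\tilde{\sqcup}\, z_{s_1,\dots, s_{k-1}} = \sum_{\substack{t_i\geq 1\\ t_1+\cdots+t_{k}=n}} C(t_1,\dots, t_{k-1})\, z_{t_1,\dots, t_{k}}. $$
   Context: Let $\mathcal{H}$ be the free $\mathbb{Z}$-module on words in letters $z_s$ ($s\geq1$), with $z_{s_1,\dots,s_k}:=z_{s_1}\cdots z_{s_k}$ and $1$ the empty word. Let $\mathbb{Z}\langle x_0,x_1\rangle$ be the free $\mathbb{Z}$-module on words in two letters $x_0,x_1$, with the shuffle product $\sqcup$ defined bilinearly and recursively by $1\sqcup u=u\sqcup 1=u$ and $(au)\sqcup(bv)=a(u\sqcup (bv))+b((au)\sqcup v)$ for letters $a,b\in\{x_0,x_1\}$ and words $u,v$. Let $\rho$ be the $\mathbb{Z}$-linear bijection from $\mathbb{Z}\oplus \mathbb{Z}\langle x_0,x_1\rangle x_1$ (span of $1$ and words ending in $x_1$) onto $\mathcal{H}$ given by $\rho(1)=1$ and $\rho(x_0^{s_1-1}x_1\cdots x_0^{s_k-1}x_1)=z_{s_1,\dots,s_k}$. Define the product $\tilde{\sqcup}$ on $\mathcal{H}$ by $w_1\,\tilde{\sqcup}\,w_2=\rho\big(\rho^{ -1}(w_1)\sqcup\rho^{ -1}(w_2)\big)$. For positive integers $t_1,\dots,t_{k-1}$ ($k\geq 2$) with $T_j=t_1+\cdots+t_j$,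 set $C(t_1,\dots,t_{k-1})=\sum_{j=1}^{k-1}2^{T_j-j}+2^{T_{k-1}-(k-1)}$ (so for $k=2$, $C(t_1)=2^{t_1}$). -}

module Defs where

open import Data.Integer.Base as ℤ using (ℤ; 0ℤ; 1ℤ)
open import Data.List.Base as List using (List; []; _∷_; _++_; concatMap; replicate; upTo)
open import Data.List.Membership.Propositional using (_∈_; find; lose)
open import Data.List.Membership.Propositional.Properties using (∈-concatMap⁺; ∈-concatMap⁻; ∈-map⁺; ∈-map⁻; ∈-upTo⁺; ∈-upTo⁻)
open import Data.List.Properties using (≡-dec)
open import Data.List.Relation.Unary.All as All using (All; []; _∷_)
import Data.List.Relation.Unary.All.Properties as All
open import Data.List.Relation.Unary.Any using (here)
import Data.List.Relation.Unary.AllPairs as AllPairs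
import Data.List.Relation.Unary.AllPairs.Properties as AllPairs
open import Data.List.Relation.Binary.Disjoint.Propositional using (Disjoint)
open import Data.List.Relation.Unary.Unique.Propositional using (Unique; []; _∷_)
import Data.List.Relation.Unary.Unique.Propositional.Properties as Unique
open import Data.Nat.Base using (ℕ; zero; suc; pred; _+_; _∸_; _^_; NonZero; s≤s)
open import Data.Nat.ListAction using (sum)
open import Data.Nat.Properties as ℕ using (+-suc; +-identityʳ; m+[n∸m]≡n; m+n∸m≡n; m≤m+n)
open import Data.Product.Base using (∃; _×_; _,_; proj₁; proj₂; map₁; map₂)
open import Data.Vec.Base as Vec using (Vec; []; _∷_)
open import Data.Vec.Properties using (∷-injectiveˡ; ∷-injectiveʳ)
open import Function.Base using (_∘_)
open import Relation.Binary.Definitions using (DecidableEquality)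
open import Relation.Binary.PropositionalEquality using (_≡_; _≢_; refl; sym; trans; cong; cong₂)
open import Relation.Nullary.Decidable using (yes; no; map′)

private
  variable
    A B D I : Set

-- An element is a formal sum of terms (coefficient , basis element), possibly
-- with repeated basis elements; equality in the module is _≈_ below, that is,
-- equality of all collected coefficients.

Free : Set → Set
Free A = List (ℤ × A)

⟨_⟩ : A → Free A
⟨ a ⟩ = (1ℤ , a) ∷ []

infixl 6 _⊕_
infixr 7 _·_

_⊕_ : Free A → Free A → Free A
_⊕_ = _++_

_·_ : ℤ → Free A → Free A
c · u = List.map (map₁ (c ℤ.*_)) u

∑ : List I → (I → Free A) → Free A
∑ is f = concatMap f is

infix 5 ∑
syntax ∑ is (λ i → u) = ∑[ i ∈ is ] u

linear : (A → B) → Free A → Free B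
linear f = List.map (map₂ f)

bilinear : (A → B → Free D) → Free A → Free B → Free D
bilinear f u v = ∑[ (c , a) ∈ u ] ∑[ (d , b) ∈ v ] (c ℤ.* d) · f a b

module Coefficients (_≟_ : DecidableEquality A) where

  coeff : Free A → A → ℤ
  coeff []            a = 0ℤ
  coeff ((c , b) ∷ u) a with b ≟ a
  ... | yes _ = c ℤ.+ coeff u a
  ... | no  _ = coeff u a

  infix 4 _≈_

  _≈_ : Free A → Free A → Set
  u ≈ v = ∀ a → coeff u a ≡ coeff v a

-- The letter z_s is represented by its index s ≥ 1.

record ℕ⁺ : Set where
  constructor pos
  field
    value              : ℕ
    .{{value-nonZero}} : NonZero value

open ℕ⁺ public using (value)

value-injective : {s t : ℕ⁺} → value s ≡ value t → s ≡ t
value-injective refl = refl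

_≟⁺_ : DecidableEquality ℕ⁺
s ≟⁺ t = map′ value-injective (cong value) (value s ℕ.≟ value t)

ZWord : Set
ZWord = List ℕ⁺

ℋ : Set
ℋ = Free ZWord

open Coefficients (≡-dec _≟⁺_) public

z : ∀ {k} → Vec ℕ⁺ k → ℋ
z s = ⟨ Vec.toList s ⟩

data Letter : Set where
  x₀ x₁ : Letter

Word : Set
Word = List Letter

infixr 7 _◃_
infixl 6 _⧢_

_◃_ : Letter → Free Word → Free Word
a ◃ u = linear (a ∷_) u

_⧢_ : Word → Word → Free Word
[]      ⧢ v       = ⟨ v ⟩
(a ∷ u) ⧢ []      = ⟨ a ∷ u ⟩
(a ∷ u) ⧢ (b ∷ v) = a ◃ (u ⧢ (b ∷ v)) ⊕ b ◃ ((a ∷ u) ⧢ v)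

-- Free Word₁ is the submodule ℤ ⊕ ℤ⟨x₀,x₁⟩x₁ of Free Word = ℤ⟨x₀,x₁⟩.

data EndsInX₁ : Word → Set where
  [x₁] : EndsInX₁ (x₁ ∷ [])
  _∷_  : ∀ a {w} → EndsInX₁ w → EndsInX₁ (a ∷ w)

data Admissible : Word → Set where
  empty : Admissible []
  ends  : ∀ {w} → EndsInX₁ w → Admissible w

Word₁ : Set
Word₁ = ∃ Admissible

private
  ends-tail : ∀ {a w} → EndsInX₁ (a ∷ w) → Admissible w
  ends-tail [x₁]    = empty
  ends-tail (_ ∷ e) = ends e

  ◃-ends : ∀ a {u} → All (EndsInX₁ ∘ proj₂) u → All (EndsInX₁ ∘ proj₂) (a ◃ u)
  ◃-ends a es = All.map⁺ (All.map (a ∷_) es)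

  ⧢-endsʳ : ∀ {u v} → Admissible u → EndsInX₁ v → All (EndsInX₁ ∘ proj₂) (u ⧢ v)
  ⧢-endsˡ : ∀ {u v} → EndsInX₁ u → Admissible v → All (EndsInX₁ ∘ proj₂) (u ⧢ v)

  ⧢-endsʳ {[]}    {_}     _        f = f ∷ []
  ⧢-endsʳ {a ∷ u} {b ∷ v} (ends e) f =
    All.++⁺ (◃-ends a (⧢-endsʳ (ends-tail e) f)) (◃-ends b (⧢-endsˡ e (ends-tail f)))

  ⧢-endsˡ {a ∷ u} {[]}    e _        = e ∷ []
  ⧢-endsˡ {a ∷ u} {b ∷ v} e (ends f) =
    All.++⁺ (◃-ends a (⧢-endsʳ (ends-tail e) f)) (◃-ends b (⧢-endsˡ e (ends-tail f)))

⧢-admissible : ∀ {u v} → Admissible u → Admissible v → All (Admissible ∘ proj₂) (u ⧢ v)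
⧢-admissible empty    q = q ∷ []
⧢-admissible (ends e) q = All.map ends (⧢-endsˡ e q)

restrict : {u : Free Word} → All (Admissible ∘ proj₂) u → Free Word₁
restrict {[]}          []       = []
restrict {(c , w) ∷ _} (p ∷ ps) = (c , w , p) ∷ restrict ps

_⧢₁_ : Word₁ → Word₁ → Free Word₁
(u , p) ⧢₁ (v , q) = restrict (⧢-admissible p q)

-- collect m w is the image under ρ of the word x₀ᵐ w.  For admissible x₀ᵐ w
-- the [] clause is reached only with m = 0, where it gives ρ(1) = 1.

collect : ℕ → Word → ZWord
collect m []       = []
collect m (x₀ ∷ w) = collect (suc m) w
collect m (x₁ ∷ w) = pos (suc m) ∷ collect 0 w

expand : ZWord → Word
expand []      = []
expand (s ∷ w) = replicate (pred (value s)) x₀ ++ x₁ ∷ expand w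

private
  replicate-ends : ∀ m {w} → EndsInX₁ w → EndsInX₁ (replicate m x₀ ++ w)
  replicate-ends zero    e = e
  replicate-ends (suc m) e = x₀ ∷ replicate-ends m e

  x₁∷-ends : ∀ {w} → Admissible w → EndsInX₁ (x₁ ∷ w)
  x₁∷-ends empty    = [x₁]
  x₁∷-ends (ends e) = x₁ ∷ e

expand-admissible : ∀ w → Admissible (expand w)
expand-admissible []      = empty
expand-admissible (s ∷ w) =
  ends (replicate-ends (pred (value s)) (x₁∷-ends (expand-admissible w)))

ρ : Word₁ → ZWord
ρ (w , _) = collect 0 w

ρ⁻¹ : ZWord → Word₁
ρ⁻¹ w = expand w , expand-admissible w

private
  collect-replicate : ∀ m j w →
    collect m (replicate j x₀ ++ x₁ ∷ w) ≡ pos (suc (j + m)) ∷ collect 0 w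
  collect-replicate m zero    w = refl
  collect-replicate m (suc j) w = trans (collect-replicate (suc m) j w)
    (cong (_∷ collect 0 w) (value-injective (cong suc (+-suc j m))))

  replicate-snoc : ∀ m (w : Word) → replicate m x₀ ++ x₀ ∷ w ≡ x₀ ∷ replicate m x₀ ++ w
  replicate-snoc zero    w = refl
  replicate-snoc (suc m) w = cong (x₀ ∷_) (replicate-snoc m w)

  expand-collect : ∀ m {w} → EndsInX₁ w → expand (collect m w) ≡ replicate m x₀ ++ w
  expand-collect m [x₁]              = refl
  expand-collect m (_∷_ x₀ {w} e)    = trans (expand-collect (suc m) e) (sym (replicate-snoc m w))
  expand-collect m (x₁ ∷ e)          = cong (λ v → replicate m x₀ ++ x₁ ∷ v) (expand-collect 0 e)

  ends-irrelevant : ∀ {w} (e f : EndsInX₁ w) → e ≡ f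
  ends-irrelevant [x₁]     [x₁]      = refl
  ends-irrelevant [x₁]     (_ ∷ ())
  ends-irrelevant (_ ∷ ()) [x₁]
  ends-irrelevant (a ∷ e)  (.a ∷ f)  = cong (a ∷_) (ends-irrelevant e f)

  admissible-irrelevant : ∀ {w} (p q : Admissible w) → p ≡ q
  admissible-irrelevant empty     empty     = refl
  admissible-irrelevant empty     (ends ())
  admissible-irrelevant (ends ()) empty
  admissible-irrelevant (ends e)  (ends f)  = cong ends (ends-irrelevant e f)

  Word₁-≡ : {u v : Word₁} → proj₁ u ≡ proj₁ v → u ≡ v
  Word₁-≡ {w , p} {.w , q} refl = cong (w ,_) (admissible-irrelevant p q)

ρ-ρ⁻¹ : ∀ w → ρ (ρ⁻¹ w) ≡ w
ρ-ρ⁻¹ []                = refl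
ρ-ρ⁻¹ (pos (suc m) ∷ w) = trans (collect-replicate 0 m (expand w))
  (cong₂ _∷_ (value-injective (cong suc (+-identityʳ m))) (ρ-ρ⁻¹ w))

ρ⁻¹-ρ : ∀ w → ρ⁻¹ (ρ w) ≡ w
ρ⁻¹-ρ (_ , empty)  = refl
ρ⁻¹-ρ (_ , ends e) = Word₁-≡ (expand-collect 0 e)

infixl 7 _⧢~_

_⧢~_ : ℋ → ℋ → ℋ
u ⧢~ v = linear ρ (bilinear _⧢₁_ (linear ρ⁻¹ u) (linear ρ⁻¹ v))

total : ∀ {k} → Vec ℕ⁺ k → ℕ
total t = Vec.sum (Vec.map value t)

compositions : (k n : ℕ) → List (Vec ℕ⁺ k)
compositions zero    zero    = [] ∷ []
compositions zero    (suc _) = []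
compositions (suc k) n       =
  concatMap (λ i → List.map (pos (suc i) ∷_) (compositions k (n ∸ suc i))) (upTo n)

∈-compositions⁻ : ∀ k n {t} → t ∈ compositions k n → total t ≡ n
∈-compositions⁻ zero    zero {[]} _ = refl
∈-compositions⁻ (suc k) n t∈
  with i , i∈ , t∈′ ← find (∈-concatMap⁻ _ {xs = upTo n} t∈)
  with s , s∈ , refl ← ∈-map⁻ _ t∈′
  = trans (cong (suc i +_) (∈-compositions⁻ k (n ∸ suc i) s∈)) (m+[n∸m]≡n (∈-upTo⁻ i∈))

∈-compositions⁺ : ∀ k n (t : Vec ℕ⁺ k) → total t ≡ n → t ∈ compositions k n
∈-compositions⁺ zero    .0 []                refl = here refl
∈-compositions⁺ (suc k) .(suc i + total t) (pos (suc i) ∷ t) refl =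
  ∈-concatMap⁺ _ (lose (∈-upTo⁺ (s≤s (m≤m+n i (total t))))
    (∈-map⁺ _ (∈-compositions⁺ k _ t (sym (m+n∸m≡n (suc i) (total t))))))

compositions-unique : ∀ k n → Unique (compositions k n)
compositions-unique zero    zero    = [] ∷ []
compositions-unique zero    (suc n) = []
compositions-unique (suc k) n       = Unique.concat⁺
  (All.map⁺ (All.universal (λ i → Unique.map⁺ ∷-injectiveʳ (compositions-unique k _)) (upTo n)))
  (AllPairs.map⁺ (AllPairs.map disjoint (Unique.upTo⁺ n)))
  where
  block : ℕ → List (Vec ℕ⁺ (suc k))
  block i = List.map (pos (suc i) ∷_) (compositions k (n ∸ suc i))

  disjoint : ∀ {i j} → i ≢ j → Disjoint (block i) (block j)
  disjoint i≢j (v∈ , v∈′) with _ , _ , refl ← ∈-map⁻ _ v∈ | _ , _ , eq ← ∈-map⁻ _ v∈′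
    = i≢j (ℕ.suc-injective (cong value (∷-injectiveˡ eq)))

T : ∀ {m} → Vec ℕ⁺ m → ℕ → ℕ
T t j = sum (List.take j (List.map value (Vec.toList t)))

-- With m = k - 1.  The index i runs over 0, …, m - 1 and stands for j = i + 1.
-- Truncated subtraction is harmless because T t j ≥ j for j ≤ m.

C : ∀ {m} → Vec ℕ⁺ m → ℕ
C {m} t = sum (List.map (λ i → 2 ^ (T t (suc i) ∸ suc i)) (upTo m)) + 2 ^ (T t m ∸ m)

{-# OPTIONS --safe #-}
-- The coefficient of a word W in u ⧢ v is the number of ways to split W into
-- complementary subwords u and v.  Hence the coefficient of z_{t_1,…,t_k} on the
-- left counts the splittings of W = x₀^{t_1-1} x₁ ⋯ x₀^{t_k-1} x₁ into a word
-- x₀^{r-1} x₁ and a word ending in x₁.  Peeling off the first block of W doubles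
-- that number t_1 - 1 times for the letters x₀, and the letter x₁ yields
-- count(x₁ W′) = 1 + count(W′) + [W′ is a single block] for admissible W′ ≠ 1,
-- which is the recursion C(t_1, t) = 2^{t_1-1} (1 + C(t)); the value C() = 1
-- comes from the bracket, since a single block itself has no such splitting.
module Submission where

open import Defs
open import Data.Nat.Base as ℕ using (ℕ; zero; suc; pred; _+_; _∸_; _^_; _≤_; _<_; z≤n; s≤s)
import Data.Nat.Properties as ℕ
open import Data.Nat.ListAction using (sum)
open import Data.Nat.ListAction.Properties using (sum-↭)
open import Data.Integer.Base as ℤ using (ℤ; +_; 0ℤ; 1ℤ)
import Data.Integer.Properties as ℤ
open import Data.Integer.Tactic.RingSolver using (solve-∀)
open import Data.List.Base as List using (List; []; _∷_; _++_; replicate; length; applyUpTo; upTo)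
import Data.List.Properties as List
open import Data.List.Membership.Propositional using (_∈_; find; lose)
open import Data.List.Relation.Binary.Permutation.Propositional using (_↭_; ↭-sym)
open import Data.List.Relation.Binary.Permutation.Propositional.Properties using (↭-length; map⁺)
open import Data.List.Relation.Ternary.Interleaving.Propositional using (Interleaving; []; consˡ; consʳ; toPermutation)
open import Data.List.Relation.Unary.All as All using (All; []; _∷_)
open import Data.List.Relation.Unary.Any using (Any; any?; here; there)
open import Data.List.Relation.Unary.Unique.Propositional using (Unique; []; _∷_)
open import Data.Product.Base using (∃; _×_; _,_; proj₁; proj₂)
open import Data.Sum.Base using (_⊎_; inj₁; inj₂)
open import Data.Vec.Base as Vec using (Vec; []; _∷_; head; tail; init; [_]; toList; fromList)
open import Data.Vec.Properties using (toList∘fromList; length-toList; toList-injective; cast-is-id)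
open import Function.Base using (_∘_)
open import Relation.Binary.PropositionalEquality using (_≡_; _≢_; refl; sym; trans; cong; cong₂; subst; ≢-sym; module ≡-Reasoning)
open import Relation.Nullary using (¬_; Dec; yes; no; contradiction)

private
  variable
    A I : Set

-- Integer sums and coefficients in `ℋ`.

∑ℤ : List I → (I → ℤ) → ℤ
∑ℤ []       f = 0ℤ
∑ℤ (i ∷ is) f = f i ℤ.+ ∑ℤ is f

∑ℤ-cong : ∀ {f g : I → ℤ} is → (∀ {i} → i ∈ is → f i ≡ g i) → ∑ℤ is f ≡ ∑ℤ is g
∑ℤ-cong []       eq = refl
∑ℤ-cong (i ∷ is) eq = cong₂ ℤ._+_ (eq (here refl)) (∑ℤ-cong is (eq ∘ there))

∑ℤ-zero : ∀ {f : I → ℤ} is → (∀ {i} → i ∈ is → f i ≡ 0ℤ) → ∑ℤ is f ≡ 0ℤ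
∑ℤ-zero []       eq = refl
∑ℤ-zero (i ∷ is) eq = cong₂ ℤ._+_ (eq (here refl)) (∑ℤ-zero is (eq ∘ there))

∑ℤ-++ : ∀ (f : I → ℤ) is js → ∑ℤ (is ++ js) f ≡ ∑ℤ is f ℤ.+ ∑ℤ js f
∑ℤ-++ f []       js = sym (ℤ.+-identityˡ _)
∑ℤ-++ f (i ∷ is) js = trans (cong (ℤ._+_ (f i)) (∑ℤ-++ f is js)) (sym (ℤ.+-assoc (f i) _ _))

∑ℤ-single : ∀ {f : I → ℤ} {is i} → Unique is → i ∈ is → (∀ j → j ≢ i → f j ≡ 0ℤ) → ∑ℤ is f ≡ f i
∑ℤ-single {f = f} {j ∷ is} (j∉ ∷ _) (here refl) zero-off =
  trans (cong (ℤ._+_ (f j)) (∑ℤ-zero is λ {k} k∈ → zero-off k (≢-sym (All.lookup j∉ k∈)))) (ℤ.+-identityʳ _)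
∑ℤ-single (j∉ ∷ u) (there i∈) zero-off =
  trans (cong₂ ℤ._+_ (zero-off _ (All.lookup j∉ i∈)) (∑ℤ-single u i∈ zero-off)) (ℤ.+-identityˡ _)

coeff-⊕ : ∀ (u v : ℋ) w → coeff (u ⊕ v) w ≡ coeff u w ℤ.+ coeff v w
coeff-⊕ []            v w = sym (ℤ.+-identityˡ _)
coeff-⊕ ((c , b) ∷ u) v w with List.≡-dec _≟⁺_ b w
... | yes _ = trans (cong (λ x → c ℤ.+ x) (coeff-⊕ u v w)) (sym (ℤ.+-assoc c _ _))
... | no  _ = coeff-⊕ u v w

coeff-∑ : ∀ (f : I → ℋ) is w → coeff (∑ is f) w ≡ ∑ℤ is (λ i → coeff (f i) w)
coeff-∑ f []       w = refl
coeff-∑ f (i ∷ is) w = trans (coeff-⊕ (f i) (∑ is f) w) (cong (ℤ._+_ (coeff (f i) w)) (coeff-∑ f is w))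

coeff-term-≡ : ∀ c w → coeff ((c , w) ∷ []) w ≡ c
coeff-term-≡ c w with List.≡-dec _≟⁺_ w w
... | yes _  = ℤ.+-identityʳ c
... | no w≢w = contradiction refl w≢w

coeff-term-≢ : ∀ c {v w} → v ≢ w → coeff ((c , v) ∷ []) w ≡ 0ℤ
coeff-term-≢ c {v} {w} v≢w with List.≡-dec _≟⁺_ v w
... | yes v≡w = contradiction v≡w v≢w
... | no _    = refl

-- Coefficients of words in `x₀` and `x₁`.

δᴸ : Letter → Letter → ℤ
δᴸ x₀ x₀ = 1ℤ
δᴸ x₁ x₁ = 1ℤ
δᴸ _  _  = 0ℤ

-- Defined as a product over letters, so that removing a first letter is a computation and shuffle
-- recursions unfold by themselves.
δ : Word → Word → ℤ
δ []      []      = 1ℤ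
δ (a ∷ u) (b ∷ v) = δᴸ a b ℤ.* δ u v
δ _       _       = 0ℤ

δ-refl : ∀ u → δ u u ≡ 1ℤ
δ-refl []       = refl
δ-refl (x₀ ∷ u) = trans (ℤ.*-identityˡ _) (δ-refl u)
δ-refl (x₁ ∷ u) = trans (ℤ.*-identityˡ _) (δ-refl u)

δ-cases : ∀ u v → u ≡ v ⊎ δ u v ≡ 0ℤ
δ-cases []       []       = inj₁ refl
δ-cases []       (_ ∷ _)  = inj₂ refl
δ-cases (_ ∷ _)  []       = inj₂ refl
δ-cases (x₀ ∷ u) (x₁ ∷ v) = inj₂ refl
δ-cases (x₁ ∷ u) (x₀ ∷ v) = inj₂ refl
δ-cases (x₀ ∷ u) (x₀ ∷ v) with δ-cases u v
... | inj₁ eq = inj₁ (cong (x₀ ∷_) eq)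
... | inj₂ eq = inj₂ (cong (1ℤ ℤ.*_) eq)
δ-cases (x₁ ∷ u) (x₁ ∷ v) with δ-cases u v
... | inj₁ eq = inj₁ (cong (x₁ ∷_) eq)
... | inj₂ eq = inj₂ (cong (1ℤ ℤ.*_) eq)

δ-≢ : ∀ {u v} → u ≢ v → δ u v ≡ 0ℤ
δ-≢ {u} {v} u≢v with δ-cases u v
... | inj₁ eq = contradiction eq u≢v
... | inj₂ eq = eq

δ*δ-zero : ∀ u v {a b} → ¬ (u ≡ a × v ≡ b) → δ u a ℤ.* δ v b ≡ 0ℤ
δ*δ-zero u v {a} {b} ¬eq with δ-cases u a
... | inj₂ eq = cong (ℤ._* δ v b) eq
... | inj₁ u≡a = trans (cong (δ u a ℤ.*_) (δ-≢ λ v≡b → ¬eq (u≡a , v≡b))) (ℤ.*-zeroʳ (δ u a))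

coeffᵂ : Free Word → Word → ℤ
coeffᵂ u w = ∑ℤ u λ (c , v) → c ℤ.* δ v w

coeffᵂ-⟨⟩ : ∀ v w → coeffᵂ ⟨ v ⟩ w ≡ δ v w
coeffᵂ-⟨⟩ v w = trans (ℤ.+-identityʳ _) (ℤ.*-identityˡ _)

coeffᵂ-◃-[] : ∀ a u → coeffᵂ (a ◃ u) [] ≡ 0ℤ
coeffᵂ-◃-[] a []            = refl
coeffᵂ-◃-[] a ((c , _) ∷ u) = cong₂ ℤ._+_ (ℤ.*-zeroʳ c) (coeffᵂ-◃-[] a u)

coeffᵂ-◃-∷ : ∀ a u b w → coeffᵂ (a ◃ u) (b ∷ w) ≡ δᴸ a b ℤ.* coeffᵂ u w
coeffᵂ-◃-∷ a []            b w = sym (ℤ.*-zeroʳ (δᴸ a b))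
coeffᵂ-◃-∷ a ((c , v) ∷ u) b w =
  trans (cong (λ x → c ℤ.* (δᴸ a b ℤ.* δ v w) ℤ.+ x) (coeffᵂ-◃-∷ a u b w)) (lemma c (δᴸ a b) (δ v w) _)
  where
  lemma : ∀ c d e r → c ℤ.* (d ℤ.* e) ℤ.+ d ℤ.* r ≡ d ℤ.* (c ℤ.* e ℤ.+ r)
  lemma = solve-∀

-- Since `ρ` is a bijection, a term of `u` is sent to `w` exactly when its word is `expand w`, so
-- collecting terms commutes with `ρ`.
coeff-restrict : ∀ {u} (ps : All (Admissible ∘ proj₂) u) w →
  coeff (linear ρ (restrict ps)) w ≡ coeffᵂ u (expand w)
coeff-restrict {[]}          []       w = refl
coeff-restrict {(c , v) ∷ u} (p ∷ ps) w with List.≡-dec _≟⁺_ (ρ (v , p)) w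
... | yes refl = cong₂ ℤ._+_
  (sym (trans (cong (c ℤ.*_) (trans (cong (δ v) (cong proj₁ (ρ⁻¹-ρ (v , p)))) (δ-refl v))) (ℤ.*-identityʳ c)))
  (coeff-restrict ps w)
... | no ρv≢w = trans (coeff-restrict ps w) (sym (trans
  (cong (λ x → c ℤ.* x ℤ.+ coeffᵂ u (expand w)) (δ-≢ v≢))
  (trans (cong (ℤ._+ coeffᵂ u (expand w)) (ℤ.*-zeroʳ c)) (ℤ.+-identityˡ _))))
  where
  v≢ : v ≢ expand w
  v≢ eq = ρv≢w (trans (cong (collect 0) eq) (ρ-ρ⁻¹ w))

1·-identity : (u : Free A) → 1ℤ · u ≡ u
1·-identity []            = refl
1·-identity ((c , a) ∷ u) = cong₂ (λ d v → (d , a) ∷ v) (ℤ.*-identityˡ c) (1·-identity u)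

z⧢~z : ∀ {k l} (s : Vec ℕ⁺ k) (t : Vec ℕ⁺ l) → z s ⧢~ z t ≡ linear ρ (ρ⁻¹ (toList s) ⧢₁ ρ⁻¹ (toList t))
z⧢~z s t = cong (linear ρ)
  (trans (List.++-identityʳ _) (trans (List.++-identityʳ _) (1·-identity _)))

-- Splitting sums and coefficients of shuffles.

-- unshuffle ψ w is the sum of ψ a b over all splittings of w into a subword a
-- and the complementary subword b, counted with multiplicity.

unshuffle : (Word → Word → ℤ) → Word → ℤ
unshuffle ψ []      = ψ [] []
unshuffle ψ (c ∷ w) = unshuffle (λ a b → ψ (c ∷ a) b) w ℤ.+ unshuffle (λ a b → ψ a (c ∷ b)) w

-- Agreement is required only on genuine splittings; the interleaving later shows that `a` and `b`
-- together use exactly the letters of `w`.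
unshuffle-cong : ∀ {ψ φ} w → (∀ {a b} → Interleaving a b w → ψ a b ≡ φ a b) → unshuffle ψ w ≡ unshuffle φ w
unshuffle-cong []      eq = eq []
unshuffle-cong (c ∷ w) eq = cong₂ ℤ._+_ (unshuffle-cong w (eq ∘ consˡ)) (unshuffle-cong w (eq ∘ consʳ))

unshuffle-+ : ∀ ψ φ w → unshuffle (λ a b → ψ a b ℤ.+ φ a b) w ≡ unshuffle ψ w ℤ.+ unshuffle φ w
unshuffle-+ ψ φ []      = refl
unshuffle-+ ψ φ (c ∷ w) = trans
  (cong₂ ℤ._+_ (unshuffle-+ (λ a b → ψ (c ∷ a) b) (λ a b → φ (c ∷ a) b) w)
               (unshuffle-+ (λ a b → ψ a (c ∷ b)) (λ a b → φ a (c ∷ b)) w))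
  (lemma (unshuffle (λ a b → ψ (c ∷ a) b) w) (unshuffle (λ a b → φ (c ∷ a) b) w)
         (unshuffle (λ a b → ψ a (c ∷ b)) w) (unshuffle (λ a b → φ a (c ∷ b)) w))
  where
  lemma : ∀ a b c d → a ℤ.+ b ℤ.+ (c ℤ.+ d) ≡ a ℤ.+ c ℤ.+ (b ℤ.+ d)
  lemma = solve-∀

unshuffle-* : ∀ k ψ w → unshuffle (λ a b → k ℤ.* ψ a b) w ≡ k ℤ.* unshuffle ψ w
unshuffle-* k ψ []      = refl
unshuffle-* k ψ (c ∷ w) = trans (cong₂ ℤ._+_ (unshuffle-* k _ w) (unshuffle-* k _ w)) (sym (ℤ.*-distribˡ-+ k _ _))

unshuffle-zero : ∀ {ψ} w → (∀ {a b} → Interleaving a b w → ψ a b ≡ 0ℤ) → unshuffle ψ w ≡ 0ℤ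
unshuffle-zero []      eq = eq []
unshuffle-zero (c ∷ w) eq = cong₂ ℤ._+_ (unshuffle-zero w (eq ∘ consˡ)) (unshuffle-zero w (eq ∘ consʳ))

unshuffle-∑ℤ : ∀ (ψ : I → Word → Word → ℤ) is w →
  unshuffle (λ a b → ∑ℤ is (λ i → ψ i a b)) w ≡ ∑ℤ is (λ i → unshuffle (ψ i) w)
unshuffle-∑ℤ ψ []       w = unshuffle-zero w (λ _ → refl)
unshuffle-∑ℤ ψ (i ∷ is) w =
  trans (unshuffle-+ (ψ i) _ w) (cong (ℤ._+_ (unshuffle (ψ i) w)) (unshuffle-∑ℤ ψ is w))

-- The factor `δ [] a` leaves only the splitting that sends every letter to the right subword.
unshuffle-[]ˡ : ∀ f w → unshuffle (λ a b → δ [] a ℤ.* f b) w ≡ f w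
unshuffle-[]ˡ f []      = ℤ.*-identityˡ (f [])
unshuffle-[]ˡ f (c ∷ w) =
  trans (cong₂ ℤ._+_ (unshuffle-zero w (λ _ → refl)) (unshuffle-[]ˡ (f ∘ (c ∷_)) w)) (ℤ.+-identityˡ _)

unshuffle-[]ʳ : ∀ f w → unshuffle (λ a b → f a ℤ.* δ [] b) w ≡ f w
unshuffle-[]ʳ f []      = ℤ.*-identityʳ (f [])
unshuffle-[]ʳ f (c ∷ w) =
  trans (cong₂ ℤ._+_ (unshuffle-[]ʳ (f ∘ (c ∷_)) w) (unshuffle-zero w (λ {a} _ → ℤ.*-zeroʳ (f a)))) (ℤ.+-identityʳ _)

-- The two summands of the shuffle recursion correspond to the two destinations of the first letter
-- of `w`: the left subword, which must then start with `a`, or the right one, which must then start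
-- with `b`.
coeffᵂ-⧢ : ∀ u v w → coeffᵂ (u ⧢ v) w ≡ unshuffle (λ a b → δ u a ℤ.* δ v b) w
coeffᵂ-⧢ []      v  w = trans (coeffᵂ-⟨⟩ v w) (sym (unshuffle-[]ˡ (δ v) w))
coeffᵂ-⧢ (a ∷ u) [] w = trans (coeffᵂ-⟨⟩ (a ∷ u) w) (sym (unshuffle-[]ʳ (δ (a ∷ u)) w))
coeffᵂ-⧢ (a ∷ u) (b ∷ v) [] =
  trans (∑ℤ-++ _ (a ◃ (u ⧢ (b ∷ v))) _)
    (cong₂ ℤ._+_ (coeffᵂ-◃-[] a (u ⧢ (b ∷ v))) (coeffᵂ-◃-[] b ((a ∷ u) ⧢ v)))
coeffᵂ-⧢ (a ∷ u) (b ∷ v) (c ∷ w) =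
  trans (∑ℤ-++ _ (a ◃ (u ⧢ (b ∷ v))) _) (cong₂ ℤ._+_ left right)
  where
  open ≡-Reasoning
  swap : ∀ x y z → x ℤ.* (y ℤ.* z) ≡ y ℤ.* (x ℤ.* z)
  swap = solve-∀

  left : coeffᵂ (a ◃ (u ⧢ (b ∷ v))) (c ∷ w) ≡ unshuffle (λ a′ b′ → δ (a ∷ u) (c ∷ a′) ℤ.* δ (b ∷ v) b′) w
  left = begin
    coeffᵂ (a ◃ (u ⧢ (b ∷ v))) (c ∷ w)
      ≡⟨ coeffᵂ-◃-∷ a (u ⧢ (b ∷ v)) c w ⟩
    δᴸ a c ℤ.* coeffᵂ (u ⧢ (b ∷ v)) w
      ≡⟨ cong (δᴸ a c ℤ.*_) (coeffᵂ-⧢ u (b ∷ v) w) ⟩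
    δᴸ a c ℤ.* unshuffle (λ a′ b′ → δ u a′ ℤ.* δ (b ∷ v) b′) w
      ≡⟨ unshuffle-* (δᴸ a c) _ w ⟨
    unshuffle (λ a′ b′ → δᴸ a c ℤ.* (δ u a′ ℤ.* δ (b ∷ v) b′)) w
      ≡⟨ unshuffle-cong w (λ {a′} _ → sym (ℤ.*-assoc (δᴸ a c) (δ u a′) _)) ⟩
    unshuffle (λ a′ b′ → δ (a ∷ u) (c ∷ a′) ℤ.* δ (b ∷ v) b′) w ∎

  right : coeffᵂ (b ◃ ((a ∷ u) ⧢ v)) (c ∷ w) ≡ unshuffle (λ a′ b′ → δ (a ∷ u) a′ ℤ.* δ (b ∷ v) (c ∷ b′)) w
  right = begin
    coeffᵂ (b ◃ ((a ∷ u) ⧢ v)) (c ∷ w)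
      ≡⟨ coeffᵂ-◃-∷ b ((a ∷ u) ⧢ v) c w ⟩
    δᴸ b c ℤ.* coeffᵂ ((a ∷ u) ⧢ v) w
      ≡⟨ cong (δᴸ b c ℤ.*_) (coeffᵂ-⧢ (a ∷ u) v w) ⟩
    δᴸ b c ℤ.* unshuffle (λ a′ b′ → δ (a ∷ u) a′ ℤ.* δ v b′) w
      ≡⟨ unshuffle-* (δᴸ b c) _ w ⟨
    unshuffle (λ a′ b′ → δᴸ b c ℤ.* (δ (a ∷ u) a′ ℤ.* δ v b′)) w
      ≡⟨ unshuffle-cong w (λ {a′} {b′} _ → swap (δᴸ b c) (δ (a ∷ u) a′) (δ v b′)) ⟩
    unshuffle (λ a′ b′ → δ (a ∷ u) a′ ℤ.* δ (b ∷ v) (c ∷ b′)) w ∎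

-- Blocks and words ending in `x₁`.

-- Indicator function of the words x₀ⁱ x₁, the images of the letters z_{i+1}.

isBlock : Word → ℤ
isBlock []       = 0ℤ
isBlock (x₀ ∷ w) = isBlock w
isBlock (x₁ ∷ w) = δ [] w

-- The two summands in the last clause are never both nonzero, because the second vanishes on the
-- empty word; hence the values are 0 and 1.
endsInX₁ : Word → ℤ
endsInX₁ []       = 0ℤ
endsInX₁ (x₀ ∷ w) = endsInX₁ w
endsInX₁ (x₁ ∷ w) = δ [] w ℤ.+ endsInX₁ w

isBlock-replicate : ∀ p w → isBlock (replicate p x₀ ++ w) ≡ isBlock w
isBlock-replicate zero    w = refl
isBlock-replicate (suc p) w = isBlock-replicate p w

endsInX₁-replicate : ∀ p w → endsInX₁ (replicate p x₀ ++ w) ≡ endsInX₁ w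
endsInX₁-replicate zero    w = refl
endsInX₁-replicate (suc p) w = endsInX₁-replicate p w

δ-[]-expand : ∀ s w → δ [] (expand (s ∷ w)) ≡ 0ℤ
δ-[]-expand (pos (suc zero))    w = refl
δ-[]-expand (pos (suc (suc _))) w = refl

isBlock-expand : ∀ s → isBlock (expand (s ∷ [])) ≡ 1ℤ
isBlock-expand s = isBlock-replicate (pred (value s)) _

isBlock-expand-∷∷ : ∀ s t w → isBlock (expand (s ∷ t ∷ w)) ≡ 0ℤ
isBlock-expand-∷∷ s t w = trans (isBlock-replicate (pred (value s)) _) (δ-[]-expand t w)

endsInX₁-expand : ∀ s w → endsInX₁ (expand (s ∷ w)) ≡ 1ℤ
endsInX₁-expand s []      = endsInX₁-replicate (pred (value s)) _
endsInX₁-expand s (t ∷ w) =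
  trans (endsInX₁-replicate (pred (value s)) _) (cong₂ ℤ._+_ (δ-[]-expand t w) (endsInX₁-expand t w))

incr : ℕ⁺ → ℕ⁺
incr s = pos (suc (value s))

expand-incr : ∀ s w → x₀ ∷ expand (s ∷ w) ≡ expand (incr s ∷ w)
expand-incr (pos (suc n)) w = refl

isBlock-cases : ∀ w → (∃ λ s → w ≡ expand (s ∷ [])) ⊎ isBlock w ≡ 0ℤ
isBlock-cases []           = inj₂ refl
isBlock-cases (x₁ ∷ [])    = inj₁ (pos 1 , refl)
isBlock-cases (x₁ ∷ _ ∷ _) = inj₂ refl
isBlock-cases (x₀ ∷ w)     with isBlock-cases w
... | inj₁ (s , refl) = inj₁ (incr s , expand-incr s [])
... | inj₂ eq         = inj₂ eq

-- An `x₀` in front raises the first index by one; an `x₁` in front opens a new letter of index 1.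
endsInX₁-cases : ∀ w → (∃ λ s → ∃ λ v → w ≡ expand (s ∷ v)) ⊎ endsInX₁ w ≡ 0ℤ
endsInX₁-cases []        = inj₂ refl
endsInX₁-cases (x₁ ∷ []) = inj₁ (pos 1 , [] , refl)
endsInX₁-cases (x₀ ∷ w) with endsInX₁-cases w
... | inj₁ (s , v , refl) = inj₁ (incr s , v , expand-incr s v)
... | inj₂ eq             = inj₂ eq
endsInX₁-cases (x₁ ∷ w@(_ ∷ _)) with endsInX₁-cases w
... | inj₁ (s , v , eq) = inj₁ (pos 1 , s ∷ v , cong (x₁ ∷_) eq)
... | inj₂ eq           = inj₂ (trans (ℤ.+-identityˡ _) eq)

-- The number of splittings of a word.

splittings : Word → ℤ
splittings = unshuffle (λ a b → isBlock a ℤ.* endsInX₁ b)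

-- Both indicators ignore leading letters `x₀`, so each of them may go to either side and doubles
-- the count.
splittings-replicate : ∀ p w → splittings (replicate p x₀ ++ w) ≡ + (2 ^ p) ℤ.* splittings w
splittings-replicate zero    w = sym (ℤ.*-identityˡ _)
splittings-replicate (suc p) w = begin
  splittings (replicate p x₀ ++ w) ℤ.+ splittings (replicate p x₀ ++ w)
    ≡⟨ cong₂ ℤ._+_ (splittings-replicate p w) (splittings-replicate p w) ⟩
  + (2 ^ p) ℤ.* splittings w ℤ.+ + (2 ^ p) ℤ.* splittings w
    ≡⟨ double (+ (2 ^ p)) (splittings w) ⟩
  + 2 ℤ.* + (2 ^ p) ℤ.* splittings w
    ≡⟨ cong (ℤ._* splittings w) (ℤ.pos-* 2 (2 ^ p)) ⟨
  + (2 ^ suc p) ℤ.* splittings w ∎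
  where
  open ≡-Reasoning
  double : ∀ x y → x ℤ.* y ℤ.+ x ℤ.* y ≡ + 2 ℤ.* x ℤ.* y
  double = solve-∀

-- If `x₁` goes left, it completes the block and all of `w` goes right. If it goes right, the rest
-- of the right subword is either empty, so that `w` itself is the block, or again ends in `x₁`.
splittings-x₁ : ∀ w → splittings (x₁ ∷ w) ≡ endsInX₁ w ℤ.+ (isBlock w ℤ.+ splittings w)
splittings-x₁ w = cong₂ ℤ._+_ (unshuffle-[]ˡ endsInX₁ w)
  (trans (unshuffle-cong w (λ {a} {b} _ → ℤ.*-distribˡ-+ (isBlock a) (δ [] b) (endsInX₁ b)))
    (trans (unshuffle-+ _ _ w) (cong (ℤ._+ splittings w) (unshuffle-[]ʳ isBlock w))))

splittings-expand : ∀ s w → splittings (expand (s ∷ w)) ≡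
  + (2 ^ pred (value s)) ℤ.* (endsInX₁ (expand w) ℤ.+ (isBlock (expand w) ℤ.+ splittings (expand w)))
splittings-expand s w = trans (splittings-replicate (pred (value s)) _)
  (cong (+ (2 ^ pred (value s)) ℤ.*_) (splittings-x₁ (expand w)))

splittings-single : ∀ s → splittings (expand (s ∷ [])) ≡ 0ℤ
splittings-single s = trans (splittings-expand s []) (ℤ.*-zeroʳ (+ (2 ^ pred (value s))))

-- The recursion for `C`.

sum-applyUpTo-* : ∀ c {f g : ℕ → ℕ} m → (∀ i → i < m → f i ≡ c ℕ.* g i) →
  sum (applyUpTo f m) ≡ c ℕ.* sum (applyUpTo g m)
sum-applyUpTo-* c zero    eq = sym (ℕ.*-zeroʳ c)
sum-applyUpTo-* c (suc m) eq = trans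
  (cong₂ _+_ (eq 0 (s≤s z≤n)) (sum-applyUpTo-* c m (λ i i<m → eq (suc i) (s≤s i<m))))
  (sym (ℕ.*-distribˡ-+ c _ _))

-- Every part is at least 1; this makes the truncated subtraction in the exponents of `C` a true
-- one.
j≤T : ∀ {m} (t : Vec ℕ⁺ m) j → j ≤ m → j ≤ T t j
j≤T t                 zero    _         = z≤n
j≤T (pos (suc p) ∷ t) (suc j) (s≤s j≤m) = s≤s (ℕ.≤-trans (j≤T t j j≤m) (ℕ.m≤n+m _ p))

2^T-∷ : ∀ {m} s (t : Vec ℕ⁺ m) j → j ≤ m →
  2 ^ (T (s ∷ t) (suc j) ∸ suc j) ≡ 2 ^ pred (value s) ℕ.* 2 ^ (T t j ∸ j)
2^T-∷ (pos (suc p)) t j j≤m =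
  trans (cong (2 ^_) (ℕ.+-∸-assoc p (j≤T t j j≤m))) (ℕ.^-distribˡ-+-* 2 p _)

-- Putting `s` in front shifts the partial sums by one place and adds `value s ∸ 1` to each
-- exponent, so a common power of 2 factors out.
C-∷ : ∀ {m} s (t : Vec ℕ⁺ m) → C (s ∷ t) ≡ 2 ^ pred (value s) ℕ.* (1 + C t)
C-∷ {m} s t = begin
  sum (List.map (λ i → 2 ^ (T (s ∷ t) (suc i) ∸ suc i)) (upTo (suc m))) + 2 ^ (T (s ∷ t) (suc m) ∸ suc m)
    ≡⟨ cong₂ _+_ (cong sum (List.map-upTo _ (suc m))) (2^T-∷ s t m ℕ.≤-refl) ⟩
  sum (applyUpTo (λ i → 2 ^ (T (s ∷ t) (suc i) ∸ suc i)) (suc m)) + c ℕ.* last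
    ≡⟨ cong (_+ c ℕ.* last) (sum-applyUpTo-* c (suc m) (λ i i<1+m → 2^T-∷ s t i (ℕ.≤-pred i<1+m))) ⟩
  c ℕ.* sum (applyUpTo (λ i → 2 ^ (T t i ∸ i)) (suc m)) + c ℕ.* last
    ≡⟨ ℕ.*-distribˡ-+ c _ last ⟨
  -- The summand 1 is the term with index 0, where the exponent `T t 0 ∸ 0` is 0.
  c ℕ.* (1 + sum (applyUpTo (λ i → 2 ^ (T t (suc i) ∸ suc i)) m) + last)
    ≡⟨ cong (λ x → c ℕ.* (1 + sum x + last)) (List.map-upTo _ m) ⟨
  c ℕ.* (1 + C t) ∎
  where
  open ≡-Reasoning
  c    = 2 ^ pred (value s)
  last = 2 ^ (T t m ∸ m)

splittings-C : ∀ {m} (t : Vec ℕ⁺ (2 + m)) → splittings (expand (toList t)) ≡ + C (init t)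
splittings-C (s ∷ t ∷ []) = begin
  splittings (expand (s ∷ t ∷ []))
    ≡⟨ splittings-expand s (t ∷ []) ⟩
  c ℤ.* (endsInX₁ (expand (t ∷ [])) ℤ.+ (isBlock (expand (t ∷ [])) ℤ.+ splittings (expand (t ∷ []))))
    ≡⟨ cong (c ℤ.*_) (cong₂ ℤ._+_ (endsInX₁-expand t []) (cong₂ ℤ._+_ (isBlock-expand t) (splittings-single t))) ⟩
  -- The last block contributes 1 as a word ending in `x₁` and 1 as a block; this 2 is `1 + C []`.
  c ℤ.* + 2
    ≡⟨ ℤ.pos-* (2 ^ pred (value s)) 2 ⟨
  + (2 ^ pred (value s) ℕ.* 2)
    ≡⟨ cong +_ (C-∷ s []) ⟨
  + C (init (s ∷ t ∷ [])) ∎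
  where
  open ≡-Reasoning
  c = + (2 ^ pred (value s))
splittings-C (s ∷ t@(t₁ ∷ t₂ ∷ t′)) = begin
  splittings (expand (s ∷ toList t))
    ≡⟨ splittings-expand s (toList t) ⟩
  c ℤ.* (endsInX₁ (expand (toList t)) ℤ.+ (isBlock (expand (toList t)) ℤ.+ splittings (expand (toList t))))
    ≡⟨ cong (c ℤ.*_) (cong₂ ℤ._+_ (endsInX₁-expand t₁ (t₂ ∷ toList t′))
         (cong₂ ℤ._+_ (isBlock-expand-∷∷ t₁ t₂ (toList t′)) (splittings-C t))) ⟩
  c ℤ.* + (1 + C (init t))
    ≡⟨ ℤ.pos-* (2 ^ pred (value s)) (1 + C (init t)) ⟨
  + (2 ^ pred (value s) ℕ.* (1 + C (init t)))
    ≡⟨ cong +_ (C-∷ s (init t)) ⟨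
  + C (init (s ∷ t)) ∎
  where
  open ≡-Reasoning
  c = + (2 ^ pred (value s))

-- Compositions and the bidegree of a word.

expand-injective : ∀ {v w} → expand v ≡ expand w → v ≡ w
expand-injective {v} {w} eq = trans (sym (ρ-ρ⁻¹ v)) (trans (cong (collect 0) eq) (ρ-ρ⁻¹ w))

toList-injective′ : ∀ {k} {s t : Vec A k} → toList s ≡ toList t → s ≡ t
toList-injective′ {s = s} {t} eq = trans (sym (cast-is-id refl s)) (toList-injective refl s t eq)

expand-∷ : ∀ s w → expand (s ∷ w) ≡ expand (s ∷ []) ++ expand w
expand-∷ s w = sym (List.++-assoc (replicate (pred (value s)) x₀) (x₁ ∷ []) (expand w))

length-expand : ∀ {k} (t : Vec ℕ⁺ k) → length (expand (toList t)) ≡ total t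
length-expand []                = refl
length-expand (pos (suc p) ∷ t) = trans (List.length-++ (replicate p x₀))
  (trans (cong₂ (λ x y → x + suc y) (List.length-replicate p) (length-expand t)) (ℕ.+-suc p (total t)))

-- The number of letters `x₁` is written as a sum of weights because such a sum is invariant under
-- permutations; on expanded words it is the depth, as the length is the weight.
x₁-degree : Letter → ℕ
x₁-degree x₀ = 0
x₁-degree x₁ = 1

x₁-degree-expand : ∀ w → sum (List.map x₁-degree (expand w)) ≡ length w
x₁-degree-expand []      = refl
x₁-degree-expand (s ∷ w) = trans (skip (pred (value s)) _) (cong suc (x₁-degree-expand w))
  where
  skip : ∀ p v → sum (List.map x₁-degree (replicate p x₀ ++ v)) ≡ sum (List.map x₁-degree v)
  skip zero    v = refl
  skip (suc p) v = skip p v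

-- Membership in compositions depends only on the bidegree of the expanded word.
composition-↭ : ∀ k n {t : Vec ℕ⁺ k} w → t ∈ compositions k n → expand w ↭ expand (toList t) →
  ∃ λ t′ → t′ ∈ compositions k n × toList t′ ≡ w
composition-↭ k n {t} w t∈ perm = vector w length≡ perm
  where
  length≡ : length w ≡ k
  length≡ = trans (sym (x₁-degree-expand w)) (trans (sum-↭ (map⁺ x₁-degree perm))
    (trans (x₁-degree-expand (toList t)) (length-toList t)))

  -- The length equation is an argument so that matching it with `refl` turns `fromList w` into a
  -- `Vec ℕ⁺ k`.
  vector : ∀ w → length w ≡ k → expand w ↭ expand (toList t) → ∃ λ t′ → t′ ∈ compositions k n × toList t′ ≡ w
  vector w refl perm = fromList w , ∈-compositions⁺ k n (fromList w) total≡ , toList∘fromList w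
    where
    total≡ : total (fromList w) ≡ n
    total≡ = trans (sym (length-expand (fromList w))) (trans (cong (length ∘ expand) (toList∘fromList w))
      (trans (↭-length perm) (trans (length-expand t) (∈-compositions⁻ k n t∈))))

-- Summation over compositions.

-- A composition of n into k parts stores r as its head and the remaining indices as its tail, so
-- one list indexes both sides of the theorem.
splitting : ∀ {m} → Vec ℕ⁺ (2 + m) → Word → Word → ℤ
splitting rs a b = δ (expand (head rs ∷ [])) a ℤ.* δ (expand (toList (tail rs))) b

splitting-≢ : ∀ {m} (rs : Vec ℕ⁺ (2 + m)) {a b} → a ++ b ≢ expand (toList rs) → splitting rs a b ≡ 0ℤ
splitting-≢ (r ∷ s) a++b≢ = δ*δ-zero (expand (r ∷ [])) (expand (toList s)) λ { (refl , refl) → a++b≢ (sym (expand-∷ r (toList s))) }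

coeff-z⧢~z : ∀ {m} (rs : Vec ℕ⁺ (2 + m)) w →
  coeff (z [ head rs ] ⧢~ z (tail rs)) w ≡ unshuffle (splitting rs) (expand w)
coeff-z⧢~z rs w = trans (cong (λ u → coeff u w) (z⧢~z [ head rs ] (tail rs)))
  (trans (coeff-restrict (⧢-admissible (expand-admissible (head rs ∷ [])) (expand-admissible (toList (tail rs)))) w)
    (coeffᵂ-⧢ (expand (head rs ∷ [])) (expand (toList (tail rs))) (expand w)))

-- A block and a nonempty word ending in `x₁` determine r and the remaining indices; these form a
-- composition of n because `a` and `b` share out the letters of `expand (toList t)`. Exactly one
-- summand is then 1. For other `a` or `b` both sides vanish.
∑ℤ-splitting : ∀ m n {t : Vec ℕ⁺ (2 + m)} {a b} → t ∈ compositions (2 + m) n →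
  Interleaving a b (expand (toList t)) →
  ∑ℤ (compositions (2 + m) n) (λ rs → splitting rs a b) ≡ isBlock a ℤ.* endsInX₁ b
∑ℤ-splitting m n {t} {a} {b} t∈ inter with isBlock-cases a | endsInX₁-cases b
... | inj₂ a≁ | _ = trans
  (∑ℤ-zero (compositions (2 + m) n) λ { {r ∷ s} _ →
    δ*δ-zero (expand (r ∷ [])) (expand (toList s)) λ { (refl , _) →
      contradiction (trans (sym (isBlock-expand r)) a≁) λ () } })
  (sym (cong (ℤ._* endsInX₁ b) a≁))
... | inj₁ _ | inj₂ b≁ = trans
  (∑ℤ-zero (compositions (2 + m) n) λ { {r ∷ s ∷ v} _ →
    δ*δ-zero (expand (r ∷ [])) (expand (s ∷ toList v)) λ { (_ , refl) →
      contradiction (trans (sym (endsInX₁-expand s (toList v))) b≁) λ () } })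
  (sym (trans (cong (isBlock a ℤ.*_) b≁) (ℤ.*-zeroʳ (isBlock a))))
... | inj₁ (r , refl) | inj₁ (s , w , refl) 
  with (_ ∷ _ ∷ v) , t′∈ , refl ← composition-↭ (2 + m) n (r ∷ s ∷ w) t∈
         (↭-sym (subst (expand (toList t) ↭_) (sym (expand-∷ r (s ∷ w))) (toPermutation inter)))
  = trans
    -- Any `j` with a nonzero term expands to the same concatenation `a ++ b`, hence equals the
    -- composition just found.
    (∑ℤ-single (compositions-unique (2 + m) n) t′∈ λ j j≢t′ → splitting-≢ j λ eq →
      j≢t′ (sym (toList-injective′ (expand-injective (trans (expand-∷ r (s ∷ w)) eq)))))
    (cong₂ ℤ._*_ (trans (δ-refl (expand (r ∷ []))) (sym (isBlock-expand r)))
                 (trans (δ-refl (expand (s ∷ w))) (sym (endsInX₁-expand s w))))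

theorem2p5 : (m n : ℕ) → let k = 2 + m in k ≤ n →
    (∑[ rs ∈ compositions k n ] z [ head rs ] ⧢~ z (tail rs))
    ≈ (∑[ t ∈ compositions k n ] (+ C (init t)) · z t)
theorem2p5 m n _ w = begin
  coeff (∑[ rs ∈ comps ] z [ head rs ] ⧢~ z (tail rs)) w
    ≡⟨ coeff-∑ (λ rs → z [ head rs ] ⧢~ z (tail rs)) comps w ⟩
  ∑ℤ comps (λ rs → coeff (z [ head rs ] ⧢~ z (tail rs)) w)
    ≡⟨ ∑ℤ-cong comps (λ {rs} _ → coeff-z⧢~z rs w) ⟩
  ∑ℤ comps (λ rs → unshuffle (splitting rs) (expand w))
    ≡⟨ main (any? (λ t → List.≡-dec _≟⁺_ (toList t) w) comps) ⟩
  ∑ℤ comps (λ t → coeff ((+ C (init t)) · z t) w)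
    ≡⟨ coeff-∑ (λ t → (+ C (init t)) · z t) comps w ⟨
  coeff (∑[ t ∈ comps ] (+ C (init t)) · z t) w ∎
  where
  open ≡-Reasoning
  comps = compositions (2 + m) n

  main : Dec (Any (λ t → toList t ≡ w) comps) →
    ∑ℤ comps (λ rs → unshuffle (splitting rs) (expand w)) ≡ ∑ℤ comps (λ t → coeff ((+ C (init t)) · z t) w)
  main (yes ∃t) with t , t∈ , refl ← find ∃t = begin
    ∑ℤ comps (λ rs → unshuffle (splitting rs) (expand (toList t)))
      -- Exchanging the sums lets the inner one, for a fixed splitting, collapse to a product of
      -- indicators.
      ≡⟨ unshuffle-∑ℤ splitting comps (expand (toList t)) ⟨
    unshuffle (λ a b → ∑ℤ comps (λ rs → splitting rs a b)) (expand (toList t))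
      ≡⟨ unshuffle-cong (expand (toList t)) (∑ℤ-splitting m n t∈) ⟩
    splittings (expand (toList t))
      ≡⟨ splittings-C t ⟩
    + C (init t)
      ≡⟨ ℤ.*-identityʳ _ ⟨
    + C (init t) ℤ.* 1ℤ
      ≡⟨ coeff-term-≡ _ (toList t) ⟨
    coeff ((+ C (init t)) · z t) (toList t)
      ≡⟨ ∑ℤ-single (compositions-unique (2 + m) n) t∈
           (λ s s≢t → coeff-term-≢ _ (s≢t ∘ toList-injective′)) ⟨
    ∑ℤ comps (λ s → coeff ((+ C (init s)) · z s) (toList t)) ∎
  main (no ∄t) = trans
    -- A nonzero term would make `expand w` a permutation of the expansion of `rs`, so `w` would
    -- come from a composition in the list.
    (∑ℤ-zero comps λ {rs} rs∈ → unshuffle-zero (expand w) λ inter → splitting-≢ rs λ eq →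
      let t , t∈ , t≡w = composition-↭ (2 + m) n w rs∈ (subst (expand w ↭_) eq (toPermutation inter))
      in ∄t (lose t∈ t≡w))
    (sym (∑ℤ-zero comps λ t∈ → coeff-term-≢ _ (∄t ∘ lose t∈)))
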